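{- For all integers $n\ge 0$, $$F_{n+3}^2-1=\sum_{k=0}^n\left\{3F_{k+1}^2+2\sum_{i=1}^kF_i^2\right\}.$$
   Context: The Fibonacci numbers are $F_0=0$, $F_1=1$, $F_n=F_{n-1}+F_{n-2}$ for $n\ge2$. Empty sums are $0$. -}

module Defs where

open import Data.Nat using (ℕ; zero; suc; _+_; _∸_)
open import Data.List using (map; applyUpTo)
open import Data.Nat.ListAction using (sum)

F : ℕ → ℕ
F zero          = 0
F (suc zero)    = 1
F (suc (suc n)) = F (suc n) + F n

-- Both bounds are inclusive: the indices are a, a + 1, …, b.
-- For b < a the truncated difference is 0, so the sum is empty and equals 0.
sumFromTo : ℕ → ℕ → (ℕ → ℕ) → ℕ
sumFromTo a b f = sum (map f (applyUpTo (a +_) (suc b ∸ a)))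

syntax sumFromTo a b (λ i → e) = ∑[ i ∈ a ⋯ b ] e

-- Since ∑_{i=1}^k F_i² = F_k F_{k+1}, the summand is F_{k+1} (3 F_{k+1} + 2 F_k)
-- = (F_{k+3} − F_{k+2}) (F_{k+3} + F_{k+2}), and the sum telescopes.

{-# OPTIONS --safe #-}
module Submission where

open import Defs
open import Data.Nat using (ℕ; zero; suc; _+_; _*_; _^_; _∸_; _≤_; z≤n; s≤s)
open import Data.Nat.Properties using (+-∸-assoc; m+[n∸m]≡n; +-comm; +-identityʳ)
open import Data.Nat.ListAction using (sum)
open import Data.Nat.ListAction.Properties using (sum-++)
open import Data.Nat.Solver using (module +-*-Solver)
open import Data.List using (map; applyUpTo; _∷ʳ_; [_])
open import Data.List.Properties using (applyUpTo-∷ʳ; map-++)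
open import Relation.Binary.PropositionalEquality
  using (_≡_; refl; cong; cong₂; module ≡-Reasoning)

open ≡-Reasoning
open +-*-Solver using (solve; _:=_; _:+_; _:*_; _:^_; con)

-- The sum telescopes. By `sum-F²` the inner sum is a product of consecutive Fibonacci numbers,
-- which turns the k-th summand into F_{k+3}² - F_{k+2}² (`F²-step`). What remains is F_{n+3}² minus
-- the initial square F_2² = 1.

sumFromTo-suc : ∀ {a b} (f : ℕ → ℕ) → a ≤ suc b →
  sumFromTo a (suc b) f ≡ sumFromTo a b f + f (suc b)
sumFromTo-suc {a} {b} f a≤1+b = begin
  sum (map f (applyUpTo (a +_) (suc (suc b) ∸ a)))
    -- By `a≤1+b` the truncated length grows by exactly one; the case a = b + 1, with an empty sum
    -- up to b, is included.
    ≡⟨ cong (λ m → sum (map f (applyUpTo (a +_) m))) (+-∸-assoc 1 a≤1+b) ⟩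
  sum (map f (applyUpTo (a +_) (suc l)))
    ≡⟨ cong (λ xs → sum (map f xs)) (applyUpTo-∷ʳ (a +_) l) ⟨
  sum (map f (applyUpTo (a +_) l ∷ʳ (a + l)))
    ≡⟨ cong sum (map-++ f (applyUpTo (a +_) l) [ a + l ]) ⟩
  sum (map f (applyUpTo (a +_) l) ∷ʳ f (a + l))
    ≡⟨ sum-++ (map f (applyUpTo (a +_) l)) [ f (a + l) ] ⟩
  sumFromTo a b f + (f (a + l) + 0)
    ≡⟨ cong (_+_ (sumFromTo a b f)) (+-identityʳ (f (a + l))) ⟩
  sumFromTo a b f + f (a + l)
    ≡⟨ cong (λ m → sumFromTo a b f + f m) (m+[n∸m]≡n a≤1+b) ⟩
  sumFromTo a b f + f (suc b) ∎
  where l = suc b ∸ a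

-- Geometrically, adding a square on the longer side of the F_k by F_{k+1} rectangle gives the next
-- such rectangle.
sum-F² : ∀ k → (∑[ i ∈ 1 ⋯ k ] (F i ^ 2)) ≡ F k * F (suc k)
sum-F² zero    = refl
sum-F² (suc k) = begin
  (∑[ i ∈ 1 ⋯ suc k ] (F i ^ 2))
    ≡⟨ sumFromTo-suc {1} {k} (λ i → F i ^ 2) (s≤s z≤n) ⟩
  (∑[ i ∈ 1 ⋯ k ] (F i ^ 2)) + F (suc k) ^ 2
    ≡⟨ cong (_+ F (suc k) ^ 2) (sum-F² k) ⟩
  F k * F (suc k) + F (suc k) ^ 2
    ≡⟨ identity (F k) (F (suc k)) ⟩
  F (suc k) * F (suc (suc k)) ∎
  where
  identity : ∀ x y → x * y + y ^ 2 ≡ y * (y + x)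
  identity = solve 2 (λ x y → x :* y :+ y :^ 2 := y :* (y :+ x)) refl

summand : ℕ → ℕ
summand k = 3 * F (k + 1) ^ 2 + 2 * (∑[ i ∈ 1 ⋯ k ] (F i ^ 2))

F²-step : ∀ k → F (3 + k) ^ 2 ≡ F (2 + k) ^ 2 + summand k
F²-step k = begin
  F (3 + k) ^ 2
    ≡⟨ identity (F k) (F (suc k)) ⟩
  F (2 + k) ^ 2 + (3 * F (suc k) ^ 2 + 2 * (F k * F (suc k)))
    ≡⟨ cong (_+_ (F (2 + k) ^ 2))
         (cong₂ (λ m s → 3 * F m ^ 2 + 2 * s) (+-comm k 1) (sum-F² k)) ⟨
  F (2 + k) ^ 2 + summand k ∎
  where
  -- With x = F_k and y = F_{k+1}, the recurrence unfolds F_{k+2} to y + x and F_{k+3} to (y + x) +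
  -- y.
  identity : ∀ x y → ((y + x) + y) ^ 2 ≡ (y + x) ^ 2 + (3 * y ^ 2 + 2 * (x * y))
  identity = solve 2 (λ x y →
    ((y :+ x) :+ y) :^ 2 := (y :+ x) :^ 2 :+ (con 3 :* y :^ 2 :+ con 2 :* (x :* y))) refl

-- Moving the 1 to the right keeps the induction within the naturals; the base case is 4 = 1 + 3.
F²≡1+sum : ∀ n → F (3 + n) ^ 2 ≡ 1 + sumFromTo 0 n summand
F²≡1+sum zero    = refl
F²≡1+sum (suc n) = begin
  F (4 + n) ^ 2
    ≡⟨ F²-step (suc n) ⟩
  F (3 + n) ^ 2 + summand (suc n)
    ≡⟨ cong (_+ summand (suc n)) (F²≡1+sum n) ⟩
  1 + (sumFromTo 0 n summand + summand (suc n))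
    ≡⟨ cong suc (sumFromTo-suc {0} {n} summand z≤n) ⟨
  1 + sumFromTo 0 (suc n) summand ∎

-- Opened only here because +_ would make the sections (a +_) above ambiguous.
open import Data.Integer using (+_; _-_)

mainTheorem3 : (n : ℕ) →
    + (F (n + 3) ^ 2) - + 1
    ≡ + (∑[ k ∈ 0 ⋯ n ] (3 * F (k + 1) ^ 2 + 2 * (∑[ i ∈ 1 ⋯ k ] (F i ^ 2))))
mainTheorem3 n = begin
  + (F (n + 3) ^ 2) - + 1
    ≡⟨ cong (λ m → + (F m ^ 2) - + 1) (+-comm n 3) ⟩
  + (F (3 + n) ^ 2) - + 1
    -- The resulting integer difference (1 + S) - 1 reduces to S by computation.
    ≡⟨ cong (λ m → + m - + 1) (F²≡1+sum n) ⟩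
  + sumFromTo 0 n summand ∎
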